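{- Let $m\geq 0$ and $k\geq 1$ be integers and let $n$ be a nonnegative integer with $t(m,k)\leq n\leq t(m+1,k)-1$, where \[ t(s,k)= s\left(\left\lfloor \frac{s}{k}\right\rfloor +1\right)k-\binom{\lfloor s/k\rfloor +1}{2}k^2 . \] Then $b(n,k)=m$.
   Context: For a cell $u$ of the Young diagram of a partition $\lambda$, the hook length of $u$ is the number of cells $v$ of the diagram with $v=u$, or $v$ below $u$ in the same column, or $v$ to the right of $u$ in the same row. $\alpha_k(\lambda)$ is the number of cells of the Young diagram of $\lambda$ with hook length exactly $k$. $P(n)$ is the set of partitions of $n$ (with $P(0)$ containing only the empty partition), and $b(n,k)=\max\{\alpha_k(\lambda)\colon\lambda\in P(n)\}$. -}

module Defs where

open import Data.Integer.Base as ℤ using (ℤ; +_)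
open import Data.List.Base using (List; []; _∷_; _++_; map; filter; length; upTo)
open import Data.List.Relation.Unary.All using (All)
open import Data.List.Relation.Unary.Linked using (Linked)
open import Data.Nat.Base using (ℕ; suc; _+_; _*_; _^_; _≤_; _<_; _≥_; _>_; NonZero)
open import Data.Nat.Combinatorics using (_C_)
open import Data.Nat.DivMod using (_/_)
open import Data.Nat.ListAction using (sum)
open import Data.Nat.Properties using (_≟_; _<?_)
open import Data.Product.Base using (_×_; _,_; ∃; map₁; proj₁; proj₂)
open import Data.Product.Properties using (≡-dec)
open import Data.Sum.Base using (_⊎_)
open import Relation.Binary.Definitions using (Decidable)
open import Relation.Binary.PropositionalEquality.Core using (_≡_)
open import Relation.Nullary.Decidable using (_×-dec_; _⊎-dec_)

record Partition (n : ℕ) : Set where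
  field
    parts      : List ℕ
    decreasing : Linked _≥_ parts
    positive   : All (_> 0) parts
    sums       : sum parts ≡ n

open Partition public

-- A cell is (row , column), both counted from 0, rows from top to bottom
-- and columns from left to right.
Cell : Set
Cell = ℕ × ℕ

row col : Cell → ℕ
row = proj₁
col = proj₂

-- The cells (i , j) with j smaller than the i-th part, each listed once.
diagram : List ℕ → List Cell
diagram []       = []
diagram (r ∷ rs) = map (0 ,_) (upTo r) ++ map (map₁ suc) (diagram rs)

InHook : Cell → Cell → Set
InHook u v = v ≡ u
           ⊎ (col v ≡ col u × row u < row v)
           ⊎ (row v ≡ row u × col u < col v)

inHook? : Decidable InHook
inHook? u v = ≡-dec _≟_ _≟_ v u
  ⊎-dec ((col v ≟ col u ×-dec row u <? row v)
  ⊎-dec  (row v ≟ row u ×-dec col u <? col v))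

hookLength : List ℕ → Cell → ℕ
hookLength ps u = length (filter (inHook? u) (diagram ps))

α : ∀ {n} → ℕ → Partition n → ℕ
α k p = length (filter (λ u → hookLength (parts p) u ≟ k) (diagram (parts p)))

IsMax : {A : Set} → (A → ℕ) → ℕ → Set
IsMax f m = (∃ λ x → f x ≡ m) × (∀ x → f x ≤ m)

-- b[ n , k ]≡ m says that the maximum b(n,k) of α k over the partitions
-- of n exists and equals m.
b[_,_]≡_ : ℕ → ℕ → ℕ → Set
b[ n , k ]≡ m = IsMax {Partition n} (α k) m

-- Integer-valued, so that the subtraction is not truncated.
t : (s k : ℕ) .{{_ : NonZero k}} → ℤ
t s k = + (s * (s / k + 1) * k) ℤ.- + (((s / k + 1) C 2) * k ^ 2)

{-# OPTIONS --safe #-}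

-- Read the beta numbers of λ (row length plus number of rows below) as beads on
-- an abacus with k runners.  Hooks of length k correspond to beads x ≥ k with
-- x - k empty, and t(s, k) = k Σ_{i < s} (⌊i / k⌋ + 1).
--
-- Let g(x) be the number of empty places below x on its runner.  The numbers
-- x - k g(x) are distinct, so their sum is at least 0 + 1 + ... + (ℓ - 1), whence
-- |λ| ≥ k Σ g(x).  On the beads with x - k empty, the numbers x % k + k (g(x) - 1)
-- are distinct too, so s such beads give Σ g(x) ≥ Σ_{i < s} (⌊i / k⌋ + 1).
--
-- Conversely, write n = t(m, k) + c + f k with c < k.  Beads at alternating heights
-- on each runner realise m hooks of length k with t(m, k) + c cells, and
-- lengthening the largest row by k never loses a hook of length k.
module Submission where

open import Defs
open import Data.Nat.Base using (ℕ; NonZero; _+_)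

-- Counting the list entries that satisfy a decidable predicate.

module Counting where

  open import Data.List.Base using (List; []; _∷_; _++_; map; filter; length; upTo; _∷ʳ_)
  open import Data.List.Membership.Propositional using (_∈_)
  open import Data.List.Membership.Propositional.Properties
    using (∈-filter⁺; ∈-filter⁻; ∈-length; ∈-upTo⁺; ∈-upTo⁻)
  open import Data.List.Properties using (filter-++; filter-accept; filter-reject; length-++; filter-none; upTo-∷ʳ)
  open import Data.List.Relation.Unary.All using (All; []; _∷_)
  import Data.List.Relation.Unary.All as All
  open import Data.List.Relation.Unary.AllPairs using ([]; _∷_)
  open import Data.List.Relation.Unary.Any using (here; there)
  open import Data.List.Relation.Unary.Unique.Propositional using (Unique)
  open import Data.List.Relation.Unary.Unique.Propositional.Properties using (upTo⁺; filter⁺)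
  open import Data.Nat.Base
  open import Data.Nat.Properties
  open import Data.Product.Base using (_×_; _,_; ∃)
  open import Function.Base using (_∘_)
  open import Level using (Level)
  open import Relation.Binary.PropositionalEquality
  open import Relation.Nullary using (¬_; yes; no; contradiction; does)
  open import Relation.Unary using (Pred; Decidable)
  open import Data.Bool.Base using (true; false)

  private
    variable
      a p q : Level
      A B : Set a

  module _ {P : Pred A p} (P? : Decidable P) where

    card : List A → ℕ
    card xs = length (filter P? xs)

    card-++ : ∀ xs ys → card (xs ++ ys) ≡ card xs + card ys
    card-++ xs ys = trans (cong length (filter-++ P? xs ys)) (length-++ (filter P? xs))

    card-map : (f : B → A) → ∀ xs → card (map f xs) ≡ length (filter (P? ∘ f) xs)
    card-map f [] = refl
    card-map f (x ∷ xs) with does (P? (f x))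
    ... | true  = cong suc (card-map f xs)
    ... | false = card-map f xs

    card-none : ∀ {xs} → (∀ {x} → x ∈ xs → ¬ P x) → card xs ≡ 0
    card-none ¬P = cong length (filter-none P? (All.tabulate ¬P))

    card≤1 : ∀ {xs} → Unique xs → (∀ {x y} → x ∈ xs → y ∈ xs → P x → P y → x ≡ y) → card xs ≤ 1
    card≤1 {xs} uniq eq = go (filter⁺ P? uniq) (λ x∈ y∈ →
        let x∈xs , Px = ∈-filter⁻ P? x∈
            y∈xs , Py = ∈-filter⁻ P? y∈
        in eq x∈xs y∈xs Px Py)
      where
      go : ∀ {ys} → Unique ys → (∀ {x y} → x ∈ ys → y ∈ ys → x ≡ y) → length ys ≤ 1
      go [] _ = z≤n
      go (_ ∷ []) _ = s≤s z≤n
      go ((x≢y ∷ _) ∷ _ ∷ _) eq = contradiction (eq (here refl) (there (here refl))) x≢y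

    card-∃ : ∀ xs → 1 ≤ card xs → ∃ λ x → x ∈ xs × P x
    card-∃ xs 1≤ with filter P? xs in eq
    ... | x ∷ _ = x , ∈-filter⁻ P? (subst (x ∈_) (sym eq) (here refl))

    card≥1 : ∀ {x xs} → x ∈ xs → P x → 1 ≤ card xs
    card≥1 x∈xs Px = ∈-length (∈-filter⁺ P? x∈xs Px)

  module _ {P : Pred A p} {Q : Pred A q} (P? : Decidable P) (Q? : Decidable Q) where

    card-mono : ∀ {xs} → (∀ {x} → x ∈ xs → P x → Q x) → card P? xs ≤ card Q? xs
    card-mono {[]} _ = z≤n
    card-mono {x ∷ xs} P⊆Q with P? x | Q? x
    ... | yes _ | yes _ = s≤s (card-mono (P⊆Q ∘ there))
    ... | yes Px | no ¬Qx = contradiction (P⊆Q (here refl) Px) ¬Qx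
    ... | no _ | yes _ = m≤n⇒m≤1+n (card-mono (P⊆Q ∘ there))
    ... | no _ | no _ = card-mono (P⊆Q ∘ there)

  module _ {P : Pred A p} {Q : Pred A q} (P? : Decidable P) (Q? : Decidable Q) where

    card-cong : ∀ xs → (∀ {x} → x ∈ xs → P x → Q x) → (∀ {x} → x ∈ xs → Q x → P x) →
                card P? xs ≡ card Q? xs
    card-cong xs P⊆Q Q⊆P = ≤-antisym (card-mono P? Q? P⊆Q) (card-mono Q? P? Q⊆P)

  card-≟-upTo-< : ∀ {j r} → j < r → card (_≟ j) (upTo r) ≡ 1
  card-≟-upTo-< {j} {r} j<r = ≤-antisym
    (card≤1 (_≟ j) (upTo⁺ r) (λ _ _ x≡j y≡j → trans x≡j (sym y≡j)))
    (card≥1 (_≟ j) (∈-upTo⁺ j<r) refl)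

  card-≟-upTo-≥ : ∀ {j r} → r ≤ j → card (_≟ j) (upTo r) ≡ 0
  card-≟-upTo-≥ {j} r≤j = card-none (_≟ j) λ where
    x∈ refl → contradiction (∈-upTo⁻ x∈) (≤⇒≯ r≤j)

  card-≤?-upTo : ∀ j r → card (j ≤?_) (upTo r) ≡ r ∸ j
  card-≤?-upTo j zero = sym (0∸n≡0 j)
  card-≤?-upTo j (suc r) = begin
    card (j ≤?_) (upTo (suc r))                   ≡⟨ cong (card (j ≤?_)) (upTo-∷ʳ r) ⟨
    card (j ≤?_) (upTo r ∷ʳ r)                    ≡⟨ card-++ (j ≤?_) (upTo r) (r ∷ []) ⟩
    card (j ≤?_) (upTo r) + card (j ≤?_) (r ∷ []) ≡⟨ cong (_+ card (j ≤?_) (r ∷ [])) (card-≤?-upTo j r) ⟩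
    r ∸ j + card (j ≤?_) (r ∷ [])                 ≡⟨ last ⟩
    suc r ∸ j                                     ∎
    where
    open ≡-Reasoning
    last : r ∸ j + card (j ≤?_) (r ∷ []) ≡ suc r ∸ j
    last with j ≤? r
    ... | yes j≤r rewrite filter-accept (j ≤?_) {r} {[]} j≤r =
      trans (+-comm (r ∸ j) 1) (sym (+-∸-assoc 1 j≤r))
    ... | no j≰r rewrite filter-reject (j ≤?_) {r} {[]} j≰r =
      trans (+-identityʳ _) (trans (m≤n⇒m∸n≡0 (<⇒≤ (≰⇒> j≰r))) (sym (m≤n⇒m∸n≡0 (≰⇒> j≰r))))

-- Hook lengths as arm plus leg, row by row.

module Hooks where

  open import Data.List.Base using (List; []; _∷_; map; length; upTo)
  open import Data.List.Membership.Propositional using (_∈_)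
  open import Data.List.Membership.Propositional.Properties using (∈-map⁻)
  open import Data.List.Properties using (filter-accept; filter-reject)
  open import Data.Nat.Base
  open import Data.Nat.Properties
  open import Data.Product.Base using (_,_; map₁)
  open import Data.Sum.Base using (inj₁; inj₂)
  open import Function.Base using (_∘_)
  open import Relation.Binary.PropositionalEquality
  open import Relation.Nullary using (¬_; Dec; yes; no)
  open Counting

  -- For the rows `rs` below a cell in column `j`, this is the leg length of the cell.
  leg : ℕ → List ℕ → ℕ
  leg j rs = card (j <?_) rs

  leg-< : ∀ {j r} rs → j < r → leg j (r ∷ rs) ≡ suc (leg j rs)
  leg-< {j} rs j<r = cong length (filter-accept (j <?_) j<r)

  leg-≥ : ∀ {j r} rs → r ≤ j → leg j (r ∷ rs) ≡ leg j rs
  leg-≥ {j} rs r≤j = cong length (filter-reject (j <?_) (≤⇒≯ r≤j))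

  -- A hook extends only down and to the right, so it never reaches a row above its corner.
  hookLength-suc : ∀ r rs i j → hookLength (r ∷ rs) (suc i , j) ≡ hookLength rs (i , j)
  hookLength-suc r rs i j = begin
    hookLength (r ∷ rs) u
      ≡⟨ card-++ (inHook? u) (map (0 ,_) (upTo r)) _ ⟩
    card (inHook? u) (map (0 ,_) (upTo r)) + card (inHook? u) (map (map₁ suc) (diagram rs))
      ≡⟨ cong₂ _+_ (card-none (inHook? u) none) (card-map (inHook? u) (map₁ suc) (diagram rs)) ⟩
    card (inHook? u ∘ map₁ suc) (diagram rs)
      ≡⟨ card-cong (inHook? u ∘ map₁ suc) (inHook? (i , j)) (diagram rs) (λ _ → down) (λ _ → up) ⟩
    hookLength rs (i , j) ∎
    where
    open ≡-Reasoning
    u : Cell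
    u = suc i , j
    none : ∀ {v} → v ∈ map (0 ,_) (upTo r) → ¬ InHook u v
    none v∈ h with ∈-map⁻ (0 ,_) v∈
    none v∈ (inj₁ ()) | _ , _ , refl
    none v∈ (inj₂ (inj₁ (_ , ()))) | _ , _ , refl
    none v∈ (inj₂ (inj₂ (() , _))) | _ , _ , refl
    down : ∀ {v} → InHook u (map₁ suc v) → InHook (i , j) v
    down (inj₁ refl) = inj₁ refl
    down (inj₂ (inj₁ (c , s≤s r<))) = inj₂ (inj₁ (c , r<))
    down (inj₂ (inj₂ (r≡ , c<))) = inj₂ (inj₂ (suc-injective r≡ , c<))
    up : ∀ {v} → InHook (i , j) v → InHook u (map₁ suc v)
    up (inj₁ refl) = inj₁ refl
    up (inj₂ (inj₁ (c , r<))) = inj₂ (inj₁ (c , s≤s r<))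
    up (inj₂ (inj₂ (r≡ , c<))) = inj₂ (inj₂ (cong suc r≡ , c<))

  card-column : ∀ j rs → card (λ v → col v ≟ j) (diagram rs) ≡ leg j rs
  card-column j [] = refl
  card-column j (r ∷ rs) = begin
    card (λ v → col v ≟ j) (diagram (r ∷ rs))
      ≡⟨ card-++ (λ v → col v ≟ j) (map (0 ,_) (upTo r)) _ ⟩
    card (λ v → col v ≟ j) (map (0 ,_) (upTo r)) + card (λ v → col v ≟ j) (map (map₁ suc) (diagram rs))
      ≡⟨ cong₂ _+_ (card-map (λ v → col v ≟ j) (0 ,_) (upTo r))
                   (card-map (λ v → col v ≟ j) (map₁ suc) (diagram rs)) ⟩
    card (_≟ j) (upTo r) + card (λ v → col v ≟ j) (diagram rs)
      ≡⟨ cong (card (_≟ j) (upTo r) +_) (card-column j rs) ⟩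
    card (_≟ j) (upTo r) + leg j rs
      ≡⟨ first ⟩
    leg j (r ∷ rs) ∎
    where
    open ≡-Reasoning
    first : card (_≟ j) (upTo r) + leg j rs ≡ leg j (r ∷ rs)
    first with j <? r
    ... | yes j<r rewrite card-≟-upTo-< j<r = sym (leg-< rs j<r)
    ... | no j≮r rewrite card-≟-upTo-≥ (≮⇒≥ j≮r) = sym (leg-≥ rs (≮⇒≥ j≮r))

  -- The corner and its arm occupy the columns from `j` on in the first row. The rest of the hook is
  -- what column `j` has in the rows below.
  hookLength-zero : ∀ r rs j → hookLength (r ∷ rs) (0 , j) ≡ (r ∸ j) + leg j rs
  hookLength-zero r rs j = begin
    hookLength (r ∷ rs) u
      ≡⟨ card-++ (inHook? u) (map (0 ,_) (upTo r)) _ ⟩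
    card (inHook? u) (map (0 ,_) (upTo r)) + card (inHook? u) (map (map₁ suc) (diagram rs))
      ≡⟨ cong₂ _+_ (card-map (inHook? u) (0 ,_) (upTo r))
                   (card-map (inHook? u) (map₁ suc) (diagram rs)) ⟩
    card (inHook? u ∘ (0 ,_)) (upTo r) + card (inHook? u ∘ map₁ suc) (diagram rs)
      ≡⟨ cong₂ _+_ (card-cong (inHook? u ∘ (0 ,_)) (j ≤?_) (upTo r) (λ _ → arm⁻) (λ _ → arm⁺))
                   (card-cong (inHook? u ∘ map₁ suc) (λ v → col v ≟ j) (diagram rs) (λ _ → leg⁻) (λ _ → leg⁺)) ⟩
    card (j ≤?_) (upTo r) + card (λ v → col v ≟ j) (diagram rs)
      ≡⟨ cong₂ _+_ (card-≤?-upTo j r) (card-column j rs) ⟩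
    (r ∸ j) + leg j rs ∎
    where
    open ≡-Reasoning
    u : Cell
    u = 0 , j
    arm⁻ : ∀ {x} → InHook u (0 , x) → j ≤ x
    arm⁻ (inj₁ refl) = ≤-refl
    arm⁻ (inj₂ (inj₁ (_ , ())))
    arm⁻ (inj₂ (inj₂ (_ , j<x))) = <⇒≤ j<x
    arm⁺ : ∀ {x} → j ≤ x → InHook u (0 , x)
    arm⁺ j≤x with m≤n⇒m<n∨m≡n j≤x
    ... | inj₁ j<x = inj₂ (inj₂ (refl , j<x))
    ... | inj₂ refl = inj₁ refl
    leg⁻ : ∀ {v} → InHook u (map₁ suc v) → col v ≡ j
    leg⁻ (inj₁ ())
    leg⁻ (inj₂ (inj₁ (c≡j , _))) = c≡j
    leg⁻ (inj₂ (inj₂ (() , _)))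
    leg⁺ : ∀ {v} → col v ≡ j → InHook u (map₁ suc v)
    leg⁺ c≡j = inj₂ (inj₁ (c≡j , z<s))

  hooks : ℕ → List ℕ → ℕ
  hooks k rs = card (λ u → hookLength rs u ≟ k) (diagram rs)

  rowHooks : ℕ → ℕ → List ℕ → ℕ
  rowHooks k r rs = card (λ j → (r ∸ j) + leg j rs ≟ k) (upTo r)

  hooks-∷ : ∀ k r rs → hooks k (r ∷ rs) ≡ rowHooks k r rs + hooks k rs
  hooks-∷ k r rs = begin
    hooks k (r ∷ rs)
      ≡⟨ card-++ P? (map (0 ,_) (upTo r)) _ ⟩
    card P? (map (0 ,_) (upTo r)) + card P? (map (map₁ suc) (diagram rs))
      ≡⟨ cong₂ _+_ (card-map P? (0 ,_) (upTo r)) (card-map P? (map₁ suc) (diagram rs)) ⟩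
    card (P? ∘ (0 ,_)) (upTo r) + card (P? ∘ map₁ suc) (diagram rs)
      ≡⟨ cong₂ _+_
           (card-cong (P? ∘ (0 ,_)) (λ j → (r ∸ j) + leg j rs ≟ k) (upTo r)
             (λ {j} _ → trans (sym (hookLength-zero r rs j)))
             (λ {j} _ → trans (hookLength-zero r rs j)))
           (card-cong (P? ∘ map₁ suc) (λ u → hookLength rs u ≟ k) (diagram rs)
             (λ {u} _ → trans (sym (hookLength-suc r rs (row u) (col u))))
             (λ {u} _ → trans (hookLength-suc r rs (row u) (col u)))) ⟩
    rowHooks k r rs + hooks k rs ∎
    where
    open ≡-Reasoning
    P? : ∀ u → Dec (hookLength (r ∷ rs) u ≡ k)
    P? u = hookLength (r ∷ rs) u ≟ k

-- Hooks of length k as beads that can move down by k.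

module BetaNumbers where

  open import Data.List.Base using (List; []; _∷_; map; length; upTo)
  open import Data.List.Membership.Propositional using (_∈_; _∉_)
  open import Data.List.Membership.Propositional.Properties using (∈-upTo⁺; ∈-upTo⁻)
  open import Data.List.Properties using (filter-none; length-filter)
  open import Data.List.Relation.Unary.All using (All; []; _∷_)
  import Data.List.Relation.Unary.All as All
  open import Data.List.Relation.Unary.AllPairs using (AllPairs; []; _∷_)
  open import Data.List.Relation.Unary.Any using (here; there)
  open import Data.List.Relation.Unary.Unique.Propositional.Properties using (upTo⁺)
  open import Data.Nat.Base
  open import Data.Nat.Properties
  open import Data.List.Membership.DecPropositional _≟_ using (_∉?_)
  open import Data.Nat.Tactic.RingSolver using (solve-∀)
  open import Data.Product.Base using (_×_; _,_; ∃)
  open import Relation.Binary.PropositionalEquality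
  open import Relation.Binary.Definitions using (tri<; tri≈; tri>)
  open import Relation.Nullary using (Dec; yes; no; contradiction)
  open import Relation.Nullary.Decidable using (_×-dec_)
  open Counting
  open Hooks

  beta : List ℕ → List ℕ
  beta []       = []
  beta (r ∷ rs) = r + length rs ∷ beta rs

  beta-< : ∀ {r rs y} → All (r ≥_) rs → y ∈ beta rs → y < r + length rs
  beta-< {r} {p ∷ ps} (p≤r ∷ _) (here refl) =
    ≤-trans (≤-reflexive (sym (+-suc p _))) (+-monoˡ-≤ _ p≤r)
  beta-< {r} (_ ∷ ps≤r) (there y∈) = <-trans (beta-< ps≤r y∈) (+-monoʳ-< r (n<1+n _))

  beta-decreasing : ∀ {rs} → AllPairs _≥_ rs → AllPairs _>_ (beta rs)
  beta-decreasing [] = []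
  beta-decreasing (rs≤r ∷ rs≥) = All.tabulate (beta-< rs≤r) ∷ beta-decreasing rs≥

  leg-none : ∀ {j rs} → All (j ≥_) rs → leg j rs ≡ 0
  leg-none {j} rs≤j = cong length (filter-none (j <?_) (All.map ≤⇒≯ rs≤j))

  leg-antitone : ∀ {i j} rs → i ≤ j → leg j rs ≤ leg i rs
  leg-antitone {i} {j} rs i≤j = card-mono (j <?_) (i <?_) {rs} (λ _ → ≤-<-trans i≤j)

  -- Column j meets the boundary of the diagram in the step j + length rs - leg j rs,
  -- and the vertical steps of the boundary are the beta numbers.
  column⇒∉beta : ∀ {j y rs} → AllPairs _≥_ rs → j + length rs ≡ y + leg j rs → y ∉ beta rs
  column⇒∉beta {j} {y} {p ∷ ps} (ps≤p ∷ ps≥) eq y∈ with j <? p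
  ... | yes j<p = absurd y∈
    where
    eq′ : j + length ps ≡ y + leg j ps
    eq′ = suc-injective (trans (sym (+-suc j _)) (trans eq (trans (cong (y +_) (leg-< ps j<p)) (+-suc y _))))
    absurd : y ∉ beta (p ∷ ps)
    absurd (here refl) = <⇒≱ j<p (+-cancelʳ-≤ (length ps) p j (≤-trans (m≤m+n _ _) (≤-reflexive (sym eq′))))
    absurd (there y∈) = column⇒∉beta ps≥ eq′ y∈
  ... | no j≮p = <-irrefl refl (<-≤-trans (beta-< (≤-refl ∷ ps≤p) y∈) p+ℓ≤y)
    where
    p≤j = ≮⇒≥ j≮p
    p+ℓ≤y : p + suc (length ps) ≤ y
    p+ℓ≤y = ≤-trans (+-monoˡ-≤ _ p≤j) (≤-reflexive (trans eq (trans
      (cong (y +_) (leg-none {rs = p ∷ ps} (p≤j ∷ All.map (λ q → ≤-trans q p≤j) ps≤p))) (+-identityʳ y))))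

  ∉beta⇒column : ∀ {y rs} → AllPairs _≥_ rs → y ∉ beta rs → ∃ λ j → j + length rs ≡ y + leg j rs
  ∉beta⇒column {y} [] _ = y , refl
  ∉beta⇒column {y} {p ∷ ps} (ps≤p ∷ ps≥) y∉ with <-cmp y (p + length ps)
  ... | tri≈ _ y≡ _ = contradiction (here y≡) y∉
  -- Here `y` exceeds every bead, so its column lies beyond all rows and has leg 0.
  ... | tri> _ _ y> = y ∸ suc (length ps) , (begin
      y ∸ suc (length ps) + suc (length ps) ≡⟨ m∸n+n≡m (≤-trans (m≤n+m _ p) p+ℓ≤y) ⟩
      y                                     ≡⟨ +-identityʳ y ⟨
      y + 0                                 ≡⟨ cong (y +_) (leg-none (p≤j ∷ All.map (λ q → ≤-trans q p≤j) ps≤p)) ⟨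
      y + leg (y ∸ suc (length ps)) (p ∷ ps) ∎)
    where
    open ≡-Reasoning
    p+ℓ≤y : p + suc (length ps) ≤ y
    p+ℓ≤y = ≤-trans (≤-reflexive (+-suc p _)) y>
    p≤j : p ≤ y ∸ suc (length ps)
    p≤j = m+n≤o⇒m≤o∸n p p+ℓ≤y
  -- The column found for `ps` also crosses the longer row `p`, so the number of rows and the leg
  -- both grow by one.
  ... | tri< y< _ _ with ∉beta⇒column ps≥ (λ y∈ → y∉ (there y∈))
  ...   | j , eq = j , (begin
      j + suc (length ps)    ≡⟨ +-suc j _ ⟩
      suc (j + length ps)    ≡⟨ cong suc eq ⟩
      suc (y + leg j ps)     ≡⟨ +-suc y _ ⟨
      y + suc (leg j ps)     ≡⟨ cong (y +_) (leg-< ps (≰⇒> p≰j)) ⟨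
      y + leg j (p ∷ ps)     ∎)
    where
    open ≡-Reasoning
    p≰j : p ≰ j
    p≰j p≤j = <⇒≱ y< (≤-trans (+-monoˡ-≤ _ p≤j) (≤-reflexive (trans eq
      (trans (cong (y +_) (leg-none (All.map (λ q → ≤-trans q p≤j) ps≤p))) (+-identityʳ y)))))

  -- Along a row the hook lengths strictly decrease from left to right: the arm shrinks and the leg
  -- does not grow.
  rowHooks≤1 : ∀ k r rs → rowHooks k r rs ≤ 1
  rowHooks≤1 k r rs = card≤1 (λ j → (r ∸ j) + leg j rs ≟ k) (upTo⁺ r) unique
    where
    shorter : ∀ {i j} → i < j → j < r → (r ∸ j) + leg j rs < (r ∸ i) + leg i rs
    shorter i<j j<r = +-mono-<-≤ (∸-monoʳ-< i<j (<⇒≤ j<r)) (leg-antitone rs (<⇒≤ i<j))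
    unique : ∀ {i j} → i ∈ upTo r → j ∈ upTo r →
             (r ∸ i) + leg i rs ≡ k → (r ∸ j) + leg j rs ≡ k → i ≡ j
    unique {i} {j} i∈ j∈ eqi eqj with <-cmp i j
    ... | tri≈ _ i≡j _ = i≡j
    ... | tri< i<j _ _ = contradiction (trans eqj (sym eqi)) (<⇒≢ (shorter i<j (∈-upTo⁻ j∈)))
    ... | tri> _ _ j<i = contradiction (trans eqi (sym eqj)) (<⇒≢ (shorter j<i (∈-upTo⁻ i∈)))

  -- The hook length of a cell is the distance along the boundary between the horizontal step `y` of
  -- its column and the vertical step `r + length rs` of its row.
  rowHooks⇒∉beta : ∀ {k r rs} → AllPairs _≥_ rs → 1 ≤ rowHooks k r rs →
                   ∃ λ y → y + k ≡ r + length rs × y ∉ beta rs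
  rowHooks⇒∉beta {k} {r} {rs} rs≥ 1≤ with card-∃ (λ j → (r ∸ j) + leg j rs ≟ k) (upTo r) 1≤
  ... | j , j∈ , refl = y , y+k , column⇒∉beta rs≥ (sym y+leg)
    where
    open ≡-Reasoning
    y = j + length rs ∸ leg j rs
    y+leg : y + leg j rs ≡ j + length rs
    y+leg = m∸n+n≡m (≤-trans (length-filter (j <?_) rs) (m≤n+m _ j))
    shuffle : ∀ a b c → a + (b + c) ≡ (a + c) + b
    shuffle = solve-∀
    y+k : y + ((r ∸ j) + leg j rs) ≡ r + length rs
    y+k = begin
      y + ((r ∸ j) + leg j rs)   ≡⟨ shuffle y (r ∸ j) (leg j rs) ⟩
      (y + leg j rs) + (r ∸ j)   ≡⟨ cong (_+ (r ∸ j)) y+leg ⟩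
      (j + length rs) + (r ∸ j)  ≡⟨ shuffle j (r ∸ j) (length rs) ⟨
      j + ((r ∸ j) + length rs)  ≡⟨ +-assoc j _ _ ⟨
      (j + (r ∸ j)) + length rs  ≡⟨ cong (_+ length rs) (m+[n∸m]≡n (<⇒≤ (∈-upTo⁻ j∈))) ⟩
      r + length rs              ∎

  ∉beta⇒rowHooks : ∀ {k r rs y} .{{_ : NonZero k}} → AllPairs _≥_ (r ∷ rs) →
                   y + k ≡ r + length rs → y ∉ beta rs → 1 ≤ rowHooks k r rs
  ∉beta⇒rowHooks {k} {r} {rs} {y} (rs≤r ∷ rs≥) y+k y∉ with ∉beta⇒column rs≥ y∉
  ... | j , eq = card≥1 (λ j → (r ∸ j) + leg j rs ≟ k) (∈-upTo⁺ j<r)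
                   (+-cancelˡ-≡ y _ _ (trans hook (sym y+k)))
    where
    open ≡-Reasoning
    shuffle : ∀ a b c → a + (b + c) ≡ (a + c) + b
    shuffle = solve-∀
    j<r : j < r
    -- A column beyond the first row would have leg 0, which puts `y` at or above the bead `y + k`;
    -- this contradicts k > 0.
    j<r = ≰⇒> λ r≤j → <⇒≱ (m<m+n y (>-nonZero⁻¹ k)) (≤-trans (≤-reflexive y+k)
      (≤-trans (+-monoˡ-≤ (length rs) r≤j) (≤-reflexive (trans eq (trans
        (cong (y +_) (leg-none (All.map (λ q → ≤-trans q r≤j) rs≤r))) (+-identityʳ y))))))
    hook : y + ((r ∸ j) + leg j rs) ≡ r + length rs
    hook = begin
      y + ((r ∸ j) + leg j rs)   ≡⟨ shuffle y (r ∸ j) (leg j rs) ⟩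
      (y + leg j rs) + (r ∸ j)   ≡⟨ cong (_+ (r ∸ j)) eq ⟨
      (j + length rs) + (r ∸ j)  ≡⟨ shuffle j (r ∸ j) (length rs) ⟨
      j + ((r ∸ j) + length rs)  ≡⟨ +-assoc j _ _ ⟨
      (j + (r ∸ j)) + length rs  ≡⟨ cong (_+ length rs) (m+[n∸m]≡n (<⇒≤ j<r)) ⟩
      r + length rs              ∎

  -- The condition `k ≤ x` keeps a truncated `x ∸ k` from passing for the place 0.
  Movable : ℕ → List ℕ → ℕ → Set
  Movable k xs x = k ≤ x × x ∸ k ∉ xs

  movable? : ∀ k xs x → Dec (Movable k xs x)
  movable? k xs x = k ≤? x ×-dec x ∸ k ∉? xs

  -- Each row has at most one hook of length k, and if it has one then its bead is movable.
  -- Induction on the rows adds this up.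
  hooks≤movable : ∀ k .{{_ : NonZero k}} {rs} → AllPairs _≥_ rs →
                  hooks k rs ≤ card (movable? k (beta rs)) (beta rs)
  hooks≤movable k [] = z≤n
  hooks≤movable k {r ∷ rs} (rs≤r ∷ rs≥) = begin
    hooks k (r ∷ rs)               ≡⟨ hooks-∷ k r rs ⟩
    rowHooks k r rs + hooks k rs   ≤⟨ +-mono-≤ first (≤-trans (hooks≤movable k rs≥) rest) ⟩
    card M? (x ∷ []) + card M? xs  ≡⟨ card-++ M? (x ∷ []) xs ⟨
    card M? (x ∷ xs)               ∎
    where
    open ≤-Reasoning
    x = r + length rs
    xs = beta rs
    M? = movable? k (x ∷ xs)
    first : rowHooks k r rs ≤ card M? (x ∷ [])
    first with 1 ≤? rowHooks k r rs
    ... | no 1≰ = ≤-trans (<⇒≤pred (≰⇒> 1≰)) z≤n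
    ... | yes 1≤ with rowHooks⇒∉beta rs≥ 1≤
    ...   | y , y+k , y∉ = ≤-trans (rowHooks≤1 k r rs) (card≥1 M? (here refl) (k≤x , x∸k∉))
      where
      k≤x : k ≤ x
      k≤x = ≤-trans (m≤n+m k y) (≤-reflexive y+k)
      x∸k≡y : x ∸ k ≡ y
      x∸k≡y = trans (cong (_∸ k) (sym y+k)) (m+n∸n≡m y k)
      x∸k∉ : x ∸ k ∉ x ∷ xs
      x∸k∉ (here eq) = <⇒≢ (∸-monoʳ-< (>-nonZero⁻¹ k) k≤x) eq
      x∸k∉ (there y∈) = y∉ (subst (_∈ xs) x∸k≡y y∈)
    rest : card (movable? k xs) xs ≤ card M? xs
    -- The new bead exceeds all beads of `xs`, so it blocks none of their moves.
    rest = card-mono (movable? k xs) M? λ {x′} x′∈ (k≤x′ , x′∸k∉) → k≤x′ , λ where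
      (here eq) → <⇒≢ (≤-<-trans (m∸n≤m x′ k) (beta-< rs≤r x′∈)) eq
      (there ∈xs) → x′∸k∉ ∈xs

-- Lower bounds for sums over distinct natural numbers.

module DistinctSums where

  open import Data.List.Base using ([]; _∷_; map; filter; length)
  open import Data.List.Membership.Propositional using (_∈_)
  open import Data.List.Relation.Binary.Permutation.Propositional using (↭-sym; ↭⇒↭ₛ)
  open import Data.List.Relation.Binary.Permutation.Propositional.Properties using (map⁺; ↭-length)
  open import Data.List.Relation.Binary.Permutation.Setoid.Properties using (Unique-resp-↭)
  open import Data.List.Relation.Unary.All using (All; []; _∷_)
  import Data.List.Relation.Unary.All as All
  open import Data.List.Relation.Unary.AllPairs using (AllPairs; []; _∷_)
  import Data.List.Relation.Unary.AllPairs as AllPairs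
  import Data.List.Relation.Unary.AllPairs.Properties as AllPairs
  open import Data.List.Relation.Unary.Any using (here; there)
  open import Data.List.Relation.Unary.Linked.Properties using (Linked⇒AllPairs)
  open import Data.List.Relation.Unary.Unique.Propositional using (Unique)
  open import Data.Nat.Base
  open import Data.Nat.ListAction using (sum)
  open import Data.Nat.ListAction.Properties using (sum-↭)
  open import Data.Nat.Properties
  open import Data.Product.Base using (_,_)
  open import Data.Sum.Base using (inj₁; inj₂)
  open import Function.Base using (_∘_)
  open import Relation.Binary.Construct.Flip.EqAndOrd using (decTotalOrder)
  open import Relation.Binary.PropositionalEquality
  open import Relation.Unary using (Pred; Decidable)
  open import Relation.Nullary using (does)
  open import Data.Bool.Base using (true; false)
  open import Data.List.Sort (decTotalOrder ≤-decTotalOrder) using (sort; sort-↭; sort-↗)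

  sumBelow : (ℕ → ℕ) → ℕ → ℕ
  sumBelow f zero    = 0
  sumBelow f (suc n) = sumBelow f n + f n

  sumBelow-mono : ∀ f {m n} → m ≤ n → sumBelow f m ≤ sumBelow f n
  sumBelow-mono f {n = zero} z≤n = z≤n
  sumBelow-mono f {m} {suc n} m≤1+n with m≤n⇒m<n∨m≡n m≤1+n
  ... | inj₁ m<1+n = ≤-trans (sumBelow-mono f (s≤s⁻¹ m<1+n)) (m≤m+n _ (f n))
  ... | inj₂ refl = ≤-refl

  length≤head : ∀ {y ys} → AllPairs _>_ (y ∷ ys) → length ys ≤ y
  length≤head ([] ∷ []) = z≤n
  length≤head ((y>z ∷ _) ∷ zs>) = ≤-<-trans (length≤head zs>) y>z

  module _ {f : ℕ → ℕ} (f-mono : ∀ {x y} → x ≤ y → f x ≤ f y) where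

    -- Counted from the end starting at 0, the i-th entry is at least i.
    sumBelow≤sum-decreasing : ∀ {ys} → AllPairs _>_ ys → sumBelow f (length ys) ≤ sum (map f ys)
    sumBelow≤sum-decreasing [] = z≤n
    sumBelow≤sum-decreasing {y ∷ ys} y∷ys>@(_ ∷ ys>) = ≤-trans
      (+-mono-≤ (sumBelow≤sum-decreasing ys>) (f-mono (length≤head y∷ys>)))
      (≤-reflexive (+-comm _ (f y)))

    -- Sorting changes neither length nor sum. The sort uses the reversed order, so that its output
    -- is decreasing, strictly so by uniqueness.
    sumBelow≤sum-unique : ∀ {ys} → Unique ys → sumBelow f (length ys) ≤ sum (map f ys)
    sumBelow≤sum-unique {ys} ys! = subst₂ _≤_
      (cong (sumBelow f) (↭-length (sort-↭ ys)))
      (sum-↭ (map⁺ f (sort-↭ ys)))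
      (sumBelow≤sum-decreasing (AllPairs.zipWith (λ (x≥y , x≢y) → ≤∧≢⇒< x≥y (x≢y ∘ sym))
        ( Linked⇒AllPairs (λ x≥y y≥z → ≤-trans y≥z x≥y) (sort-↗ ys)
        , Unique-resp-↭ (setoid ℕ) (↭⇒↭ₛ (↭-sym (sort-↭ ys))) ys!)))

  unique-map : ∀ {f : ℕ → ℕ} {xs} → AllPairs _>_ xs →
               (∀ {x y} → x ∈ xs → y ∈ xs → y < x → f x ≢ f y) → Unique (map f xs)
  unique-map {f} xs> f≢ = AllPairs.map⁺ (go xs> f≢)
    where
    go : ∀ {xs} → AllPairs _>_ xs → (∀ {x y} → x ∈ xs → y ∈ xs → y < x → f x ≢ f y) →
         AllPairs (λ x y → f x ≢ f y) xs
    go [] _ = []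
    go (x> ∷ xs>) f≢ = All.tabulate (λ y∈ → f≢ (here refl) (there y∈) (All.lookup x> y∈))
                     ∷ go xs> (λ x∈ y∈ → f≢ (there x∈) (there y∈))

  sum-map-cong : ∀ {f g : ℕ → ℕ} xs → (∀ {x} → x ∈ xs → f x ≡ g x) → sum (map f xs) ≡ sum (map g xs)
  sum-map-cong [] _ = refl
  sum-map-cong (x ∷ xs) f≡g = cong₂ _+_ (f≡g (here refl)) (sum-map-cong xs (f≡g ∘ there))

  sum-map-filter : ∀ {p} {P : Pred ℕ p} (P? : Decidable P) (f : ℕ → ℕ) xs →
                   sum (map f (filter P? xs)) ≤ sum (map f xs)
  sum-map-filter P? f [] = z≤n
  sum-map-filter P? f (x ∷ xs) with does (P? x)
  ... | true  = +-monoʳ-≤ (f x) (sum-map-filter P? f xs)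
  ... | false = ≤-trans (sum-map-filter P? f xs) (m≤n+m _ (f x))

-- The abacus with k runners and the lower bound for the size.

module Runners (k : ℕ) .{{_ : NonZero k}} where

  open import Data.List.Base using (List; []; _∷_; map; filter; length; upTo)
  open import Data.List.Membership.Propositional using (_∈_; _∉_)
  open import Data.List.Membership.Propositional.Properties using (∈-filter⁻)
  open import Data.List.Properties using (length-map; map-∘; upTo-∷ʳ; length-upTo; filter-accept)
  open import Data.List.Relation.Unary.AllPairs using (AllPairs; []; _∷_)
  import Data.List.Relation.Unary.AllPairs.Properties as AllPairs
  open import Data.Nat.Base
  open import Data.Nat.DivMod
  open import Data.Nat.ListAction using (sum)
  open import Data.Nat.Properties
  open import Data.List.Membership.DecPropositional _≟_ using (_∈?_; _∉?_)
  open import Data.Nat.Tactic.RingSolver using (solve-∀)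
  open import Data.Product.Base using (_×_; _,_; proj₂)
  open import Data.Sum.Base using (inj₁; inj₂)
  open import Relation.Binary.PropositionalEquality
  open import Relation.Nullary using (does)
  open import Relation.Nullary.Decidable using (¬?)
  open import Relation.Unary using (Pred; Decidable)
  open import Data.Bool.Base using (true; false)
  open import Function.Base using (id; _∘_)
  open Counting
  open Hooks
  open BetaNumbers
  open DistinctSums

  -- The residue modulo k recovers the runner; cancelling it leaves the height.
  coordinates-injective : ∀ {a b a′ b′} → a < k → a′ < k →
                          a + b * k ≡ a′ + b′ * k → a ≡ a′ × b ≡ b′
  coordinates-injective {a} {b} {a′} {b′} a<k a′<k eq = a≡a′ , *-cancelʳ-≡ b b′ k
      (+-cancelˡ-≡ a _ _ (trans eq (cong (_+ b′ * k) (sym a≡a′))))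
    where
    open ≡-Reasoning
    a≡a′ : a ≡ a′
    a≡a′ = begin
      a                  ≡⟨ m<n⇒m%n≡m a<k ⟨
      a % k              ≡⟨ [m+kn]%n≡m%n a b k ⟨
      (a + b * k) % k    ≡⟨ cong (_% k) eq ⟩
      (a′ + b′ * k) % k  ≡⟨ [m+kn]%n≡m%n a′ b′ k ⟩
      a′ % k             ≡⟨ m<n⇒m%n≡m a′<k ⟩
      a′                 ∎

  quotient-coordinate : ∀ {a} b → a < k → (a + b * k) / k ≡ b
  quotient-coordinate {a} b a<k = sym (proj₂ (coordinates-injective a<k (m%n<n x k) (m≡m%n+[m/n]*n x k)))
    where
    x = a + b * k

  weight : ℕ → ℕ
  weight i = suc (i / k)

  weight-mono : ∀ {i j} → i ≤ j → weight i ≤ weight j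
  weight-mono i≤j = s≤s (/-monoˡ-≤ k i≤j)

  -- This is `t s k` as a natural number, by `t≡minSize`.
  minSize : ℕ → ℕ
  minSize s = sumBelow weight s * k

  minSize-mono : ∀ {r s} → r ≤ s → minSize r ≤ minSize s
  minSize-mono r≤s = *-monoˡ-≤ k (sumBelow-mono weight r≤s)

  module _ {p} {P : Pred ℕ p} (P? : Decidable P) where

    card-upTo-suc : ∀ n → card P? (upTo (suc n)) ≡ card P? (upTo n) + card P? (n ∷ [])
    card-upTo-suc n = trans (cong (card P?) (sym (upTo-∷ʳ n))) (card-++ P? (upTo n) (n ∷ []))

    card-upTo-accept : ∀ {n} → P n → card P? (upTo (suc n)) ≡ suc (card P? (upTo n))
    card-upTo-accept {n} Pn = trans (card-upTo-suc n)
      (trans (cong (λ xs → card P? (upTo n) + length xs) (filter-accept P? Pn)) (+-comm _ 1))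

    card-upTo-mono : ∀ {m n} → m ≤ n → card P? (upTo m) ≤ card P? (upTo n)
    card-upTo-mono {n = zero} z≤n = z≤n
    card-upTo-mono {m} {suc n} m≤1+n with m≤n⇒m<n∨m≡n m≤1+n
    ... | inj₁ m<1+n = ≤-trans (card-upTo-mono (s≤s⁻¹ m<1+n))
                               (≤-trans (m≤m+n _ _) (≤-reflexive (sym (card-upTo-suc n))))
    ... | inj₂ refl = ≤-refl

    card-complement : ∀ xs → card P? xs + card (λ x → ¬? (P? x)) xs ≡ length xs
    card-complement [] = refl
    card-complement (x ∷ xs) with does (P? x)
    ... | true  = cong suc (card-complement xs)
    ... | false = trans (+-suc _ _) (cong suc (card-complement xs))

  module _ {xs : List ℕ} (xs> : AllPairs _>_ xs) where

    isBead? : ∀ c → Decidable (λ i → c + i * k ∈ xs)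
    isBead? c i = c + i * k ∈? xs

    isGap? : ∀ c → Decidable (λ i → c + i * k ∉ xs)
    isGap? c i = c + i * k ∉? xs

    -- Occupied and empty places at heights below `u` on runner `c`.
    beads gaps : ℕ → ℕ → ℕ
    beads c u = card (isBead? c) (upTo u)
    gaps c u = card (isGap? c) (upTo u)

    -- `gapsBelow` is g. `pushed x` is where the bead `x` ends up when all beads slide down their
    -- runners. For movable `x`, the count in `gapRank x` stops below the place `x ∸ k`, hence the
    -- `pred`, and equals g(x) - 1.
    gapsBelow pushed gapRank : ℕ → ℕ
    gapsBelow x = gaps (x % k) (x / k)
    pushed x = x % k + beads (x % k) (x / k) * k
    gapRank x = x % k + gaps (x % k) (pred (x / k)) * k

    -- Each of the `x / k` places below `x` on its runner is a bead or a gap.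
    pushed+gaps : ∀ x → pushed x + gapsBelow x * k ≡ x
    pushed+gaps x = begin
      (x % k + beads (x % k) (x / k) * k) + gapsBelow x * k  ≡⟨ factor (x % k) (beads (x % k) (x / k)) (gapsBelow x) k ⟩
      x % k + (beads (x % k) (x / k) + gapsBelow x) * k      ≡⟨ cong (λ u → x % k + u * k) total ⟩
      x % k + x / k * k                                      ≡⟨ m≡m%n+[m/n]*n x k ⟨
      x                                                      ∎
      where
      open ≡-Reasoning
      factor : ∀ a b c d → (a + b * d) + c * d ≡ a + (b + c) * d
      factor = solve-∀
      total : beads (x % k) (x / k) + gapsBelow x ≡ x / k
      total = trans (card-complement (isBead? (x % k)) (upTo (x / k))) (length-upTo (x / k))

    /-<-same-runner : ∀ {x y} → y < x → x % k ≡ y % k → y / k < x / k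
    /-<-same-runner {x} {y} y<x eq = ≰⇒> λ x/k≤y/k → <⇒≱ y<x (subst₂ _≤_
      (sym (m≡m%n+[m/n]*n x k)) (sym (m≡m%n+[m/n]*n y k))
      (+-mono-≤ (≤-reflexive eq) (*-monoˡ-≤ k x/k≤y/k)))

    -- Equal values put both beads on one runner with equally many beads below them, but `y` itself
    -- counts below `x` and not below `y`.
    pushed-injective : ∀ {x y} → x ∈ xs → y ∈ xs → y < x → pushed x ≢ pushed y
    pushed-injective {x} {y} x∈ y∈ y<x eq with coordinates-injective (m%n<n x k) (m%n<n y k) eq
    ... | %≡ , beads≡ = <⇒≢ (begin-strict
        beads c (y / k)        <⟨ n<1+n _ ⟩
        suc (beads c (y / k))  ≡⟨ card-upTo-accept (isBead? c) (subst (_∈ xs) (m≡m%n+[m/n]*n y k) y∈) ⟨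
        beads c (suc (y / k))  ≤⟨ card-upTo-mono (isBead? c) (/-<-same-runner y<x %≡) ⟩
        beads c (x / k)        ≡⟨ cong (λ c → beads c (x / k)) %≡ ⟨
        beads (x % k) (x / k)  ∎) (sym beads≡)
      where
      open ≤-Reasoning
      c = y % k

    movables : List ℕ
    movables = filter (movable? k xs) xs

    gap-below-movable : ∀ {x} → Movable k xs x → x % k + pred (x / k) * k ∉ xs × suc (pred (x / k)) ≡ x / k
    gap-below-movable {x} (k≤x , x∸k∉) = subst (_∉ xs) x∸k≡ x∸k∉ , 1+pred
      where
      1+pred : suc (pred (x / k)) ≡ x / k
      1+pred = suc-pred (x / k) {{>-nonZero (m≥n⇒m/n>0 k≤x)}}
      open ≡-Reasoning
      move : ∀ a b k → a + suc b * k ≡ k + (a + b * k)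
      move = solve-∀
      x∸k≡ : x ∸ k ≡ x % k + pred (x / k) * k
      x∸k≡ = begin
        x ∸ k                                  ≡⟨ cong (_∸ k) (m≡m%n+[m/n]*n x k) ⟩
        x % k + x / k * k ∸ k                  ≡⟨ cong (λ u → x % k + u * k ∸ k) 1+pred ⟨
        x % k + suc (pred (x / k)) * k ∸ k     ≡⟨ cong (_∸ k) (move (x % k) (pred (x / k)) k) ⟩
        k + (x % k + pred (x / k) * k) ∸ k     ≡⟨ m+n∸m≡n k _ ⟩
        x % k + pred (x / k) * k               ∎

    gapsBelow-movable : ∀ {x} → Movable k xs x → gapsBelow x ≡ suc (gaps (x % k) (pred (x / k)))
    gapsBelow-movable {x} mov with gap-below-movable mov
    ... | gap , 1+pred = trans (cong (gaps (x % k)) (sym 1+pred)) (card-upTo-accept (isGap? (x % k)) gap)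

    -- On a common runner, the gap directly below the movable bead `y` is counted for `x` and not
    -- for `y`.
    gapRank-injective : ∀ {x y} → x ∈ movables → y ∈ movables → y < x → gapRank x ≢ gapRank y
    gapRank-injective {x} {y} x∈ y∈ y<x eq
      with coordinates-injective (m%n<n x k) (m%n<n y k) eq
    ... | %≡ , gaps≡ = <⇒≢ (begin-strict
        gaps c (pred (y / k))         <⟨ n<1+n _ ⟩
        suc (gaps c (pred (y / k)))   ≡⟨ gapsBelow-movable (proj₂ (∈-filter⁻ (movable? k xs) {xs = xs} y∈)) ⟨
        gaps c (y / k)                ≤⟨ card-upTo-mono (isGap? c) (<⇒≤pred (/-<-same-runner y<x %≡)) ⟩
        gaps c (pred (x / k))         ≡⟨ cong (λ c → gaps c (pred (x / k))) %≡ ⟨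
        gaps (x % k) (pred (x / k))   ∎) (sym gaps≡)
      where
      open ≤-Reasoning
      c = y % k

    sum-split : ∀ ys → sum ys ≡ sum (map pushed ys) + sum (map gapsBelow ys) * k
    sum-split [] = refl
    sum-split (y ∷ ys) = begin
      y + sum ys
        ≡⟨ cong₂ _+_ (sym (pushed+gaps y)) (sum-split ys) ⟩
      (pushed y + gapsBelow y * k) + (sum (map pushed ys) + sum (map gapsBelow ys) * k)
        ≡⟨ regroup (pushed y) (gapsBelow y) (sum (map pushed ys)) (sum (map gapsBelow ys)) k ⟩
      (pushed y + sum (map pushed ys)) + (gapsBelow y + sum (map gapsBelow ys)) * k ∎
      where
      open ≡-Reasoning
      regroup : ∀ a b c d k → (a + b * k) + (c + d * k) ≡ (a + c) + (b + d) * k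
      regroup = solve-∀

    -- The two parts of `sum-split` are bounded separately: the pushed places are distinct, and so
    -- are the gap ranks of the movable beads.
    minSize-movables : sumBelow id (length xs) + minSize (length movables) ≤ sum xs
    minSize-movables = begin
      sumBelow id (length xs) + minSize (length movables)
        ≤⟨ +-mono-≤ pushed-sum (*-monoˡ-≤ k gaps-sum) ⟩
      sum (map pushed xs) + sum (map gapsBelow xs) * k
        ≡⟨ sum-split xs ⟨
      sum xs ∎
      where
      open ≤-Reasoning
      pushed-sum : sumBelow id (length xs) ≤ sum (map pushed xs)
      pushed-sum = begin
        sumBelow id (length xs)               ≡⟨ cong (sumBelow id) (length-map pushed xs) ⟨
        sumBelow id (length (map pushed xs))  ≤⟨ sumBelow≤sum-unique id (unique-map xs> pushed-injective) ⟩
        sum (map id (map pushed xs))          ≡⟨ cong sum (map-∘ xs) ⟨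
        sum (map pushed xs)                   ∎
      weight-gapRank : ∀ {x} → x ∈ movables → weight (gapRank x) ≡ gapsBelow x
      weight-gapRank {x} x∈ = trans
        (cong suc (quotient-coordinate (gaps (x % k) (pred (x / k))) (m%n<n x k)))
        (sym (gapsBelow-movable (proj₂ (∈-filter⁻ (movable? k xs) {xs = xs} x∈))))
      gaps-sum : sumBelow weight (length movables) ≤ sum (map gapsBelow xs)
      gaps-sum = begin
        sumBelow weight (length movables)
          ≡⟨ cong (sumBelow weight) (length-map gapRank movables) ⟨
        sumBelow weight (length (map gapRank movables))
          ≤⟨ sumBelow≤sum-unique weight-mono
               (unique-map (AllPairs.filter⁺ (movable? k xs) xs>) gapRank-injective) ⟩
        sum (map weight (map gapRank movables))
          ≡⟨ cong sum (map-∘ movables) ⟨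
        sum (map (weight ∘ gapRank) movables)
          ≡⟨ sum-map-cong movables weight-gapRank ⟩
        sum (map gapsBelow movables)
          -- The beads that are not movable can only add gaps.
          ≤⟨ sum-map-filter (movable? k xs) gapsBelow xs ⟩
        sum (map gapsBelow xs) ∎

  sum-beta : ∀ rs → sum (beta rs) ≡ sumBelow id (length rs) + sum rs
  sum-beta [] = refl
  sum-beta (r ∷ rs) = trans (cong (r + length rs +_) (sum-beta rs))
                            (regroup r (length rs) (sumBelow id (length rs)) (sum rs))
    where
    regroup : ∀ a b c d → a + b + (c + d) ≡ (c + b) + (a + d)
    regroup = solve-∀

  length-beta : ∀ rs → length (beta rs) ≡ length rs
  length-beta [] = refl
  length-beta (r ∷ rs) = cong suc (length-beta rs)

  -- The beta numbers exceed the row lengths by 0 + 1 + ... + (ℓ - 1) in total, exactly the term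
  -- that cancels.
  minSize-hooks : ∀ {rs} → AllPairs _≥_ rs → minSize (hooks k rs) ≤ sum rs
  minSize-hooks {rs} rs≥ = +-cancelˡ-≤ (sumBelow id (length rs)) _ _ (begin
    sumBelow id (length rs) + minSize (hooks k rs)
      ≤⟨ +-mono-≤ (≤-reflexive (cong (sumBelow id) (sym (length-beta rs))))
                  (minSize-mono (hooks≤movable k rs≥)) ⟩
    sumBelow id (length (beta rs)) + minSize (length (movables (beta-decreasing rs≥)))
      ≤⟨ minSize-movables (beta-decreasing rs≥) ⟩
    sum (beta rs)
      ≡⟨ sum-beta rs ⟩
    sumBelow id (length rs) + sum rs ∎)
    where open ≤-Reasoning

-- Partitions with many hooks of length k.

module Construction (k : ℕ) .{{_ : NonZero k}} where

  open import Data.Bool.Base using (Bool; true; false; not; _xor_)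
  open import Data.Bool.Properties using (not-involutive)
  open import Data.List.Base using (List; []; _∷_; length)
  open import Data.List.Membership.Propositional using (_∈_; _∉_)
  open import Data.List.Relation.Unary.All using (All; []; _∷_)
  import Data.List.Relation.Unary.All as All
  open import Data.List.Relation.Unary.AllPairs using (AllPairs; []; _∷_)
  open import Data.List.Relation.Unary.Any using (here; there)
  open import Data.Nat.Base
  open import Data.Nat.DivMod
  open import Data.Nat.ListAction using (sum)
  open import Data.Nat.Properties
  open import Data.Nat.Tactic.RingSolver using (solve-∀)
  open import Data.Product.Base using (_×_; _,_; ∃; proj₁; proj₂)
  open import Data.Sum.Base using (_⊎_; inj₁; inj₂; [_,_]′)
  open import Function.Base using (id)
  open import Relation.Binary.PropositionalEquality
  open import Relation.Nullary using (does; yes; no; contradiction)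
  open import Relation.Nullary.Decidable using (dec-true; dec-false)
  open Hooks
  open BetaNumbers
  open DistinctSums using (sumBelow)
  open Runners k

  odd : ℕ → Bool
  odd zero    = false
  odd (suc n) = not (odd n)

  odd-1+n+n : ∀ n → odd (suc (n + n)) ≡ true
  odd-1+n+n zero = refl
  odd-1+n+n (suc n) rewrite +-suc n n | odd-1+n+n n = refl

  -- Adding k flips the colour, so moving a bead by k leaves any set of beads of
  -- colour true.  The choice c ≥ k means that no runner is exceptional.
  colour : ℕ → ℕ → Bool
  colour c x = odd (x / k) xor does (x % k ≟ c)

  colour-coordinates : ∀ c {a} b → a < k → colour c (a + b * k) ≡ odd b xor does (a ≟ c)
  colour-coordinates c {a} b a<k = cong₂ (λ q r → odd q xor does (r ≟ c))
    (quotient-coordinate b a<k) (trans ([m+kn]%n≡m%n a b k) (m<n⇒m%n≡m a<k))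

  colour-+k : ∀ c x → colour c (x + k) ≡ not (colour c x)
  colour-+k c x = begin
    colour c (x + k)                          ≡⟨ cong (colour c) x+k ⟩
    colour c (x % k + suc (x / k) * k)        ≡⟨ colour-coordinates c (suc (x / k)) (m%n<n x k) ⟩
    not (odd (x / k)) xor does (x % k ≟ c)    ≡⟨ not-xor (odd (x / k)) _ ⟩
    not (colour c x)                          ∎
    where
    open ≡-Reasoning
    not-xor : ∀ a b → not a xor b ≡ not (a xor b)
    not-xor false false = refl
    not-xor false true  = refl
    not-xor true  false = refl
    not-xor true  true  = refl
    shuffle : ∀ a b k → (a + b * k) + k ≡ a + suc b * k
    shuffle = solve-∀
    x+k : x + k ≡ x % k + suc (x / k) * k
    x+k = trans (cong (_+ k) (m≡m%n+[m/n]*n x k)) (shuffle (x % k) (x / k) k)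

  colour-odd : ∀ {c x a} q → a < k → a ≢ c → x ≡ a + suc (q + q) * k → colour c x ≡ true
  colour-odd {c} {a = a} q a<k a≢c refl
    rewrite colour-coordinates c (suc (q + q)) a<k | odd-1+n+n q | dec-false (a ≟ c) a≢c = refl

  colour-even : ∀ {c x} q → c < k → x ≡ c + (q + q) * k → colour c x ≡ true
  colour-even {c} q c<k refl
    rewrite colour-coordinates c (q + q) c<k | dec-true (c ≟ c) refl
    with odd (q + q) | odd-1+n+n q
  ... | false | _ = refl

  -- The invariant of a construction that adds rows from the shortest to the longest. By `coloured`,
  -- no two beads differ by k.
  record Stack (c top len size m : ℕ) : Set where
    field
      rows       : List ℕ
      sorted     : AllPairs _≥_ rows
      bounded    : All (top ≥_) rows
      rows>0     : All (_> 0) rows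
      length≡    : length rows ≡ len
      sum≡       : sum rows ≡ size
      coloured   : ∀ {x} → x ∈ beta rows → colour c x ≡ true
      hooks≥     : m ≤ hooks k rows

  resize : ∀ {c top len len′ size size′ m m′} → len ≡ len′ → size ≡ size′ → m ≡ m′ →
           Stack c top len size m → Stack c top len′ size′ m′
  resize refl refl refl S = S

  -- A new longest row adds the bead `v + len` and leaves the other beads in place. The place k
  -- below has colour false, so it is empty and the row has a hook of length k.
  push : ∀ {c top len size m v} → Stack c top len size m → top ≤ v → 0 < v → k ≤ v + len →
         colour c (v + len) ≡ true → Stack c v (suc len) (v + size) (suc m)
  push {c} {top} {len} {size} {m} {v} S top≤v 0<v k≤x true-x = record
    { rows       = v ∷ rows
    ; sorted = v≥rows ∷ sorted
    ; bounded    = ≤-refl ∷ v≥rows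
    ; rows>0   = 0<v ∷ rows>0
    ; length≡    = cong suc length≡
    ; sum≡       = cong (v +_) sum≡
    ; coloured   = λ where
        (here refl) → subst (λ ℓ → colour c (v + ℓ) ≡ true) (sym length≡) true-x
        (there x∈)  → coloured x∈
    ; hooks≥     = ≤-trans (+-mono-≤ new hooks≥) (≤-reflexive (sym (hooks-∷ k v rows)))
    }
    where
    open Stack S
    v≥rows : All (v ≥_) rows
    v≥rows = All.map (λ p → ≤-trans p top≤v) bounded
    x = v + len
    x∸k∉ : x ∸ k ∉ beta rows
    x∸k∉ x∸k∈ with trans (sym (coloured x∸k∈)) (trans
      (sym (not-involutive _)) (trans (cong not (sym (colour-+k c (x ∸ k)))) (cong not (trans (cong (colour c) (m∸n+n≡m k≤x)) true-x))))
    ... | ()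
    new : 1 ≤ rowHooks k v rows
    new = ∉beta⇒rowHooks (v≥rows ∷ sorted)
      (trans (m∸n+n≡m k≤x) (cong (v +_) (sym length≡))) x∸k∉

  -- Equal rows give beads on consecutive places, starting at `v + len`.
  pushes : ∀ {c top len size m v} n → Stack c top len size m → top ≤ v → 0 < v → k ≤ v + len →
           (∀ {j} → j < n → colour c (v + (j + len)) ≡ true) →
           Stack c v (n + len) (n * v + size) (n + m)
  pushes zero S top≤v _ _ _ = record
    { Stack S
    ; bounded = All.map (λ p → ≤-trans p top≤v) (Stack.bounded S)
    }
  pushes {size = size} {v = v} (suc n) S top≤v 0<v k≤x col = resize refl (sym (+-assoc v (n * v) size)) refl
    (push (pushes n S top≤v 0<v k≤x (λ j<n → col (m<n⇒m<1+n j<n))) ≤-refl 0<v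
      (≤-trans k≤x (+-monoʳ-≤ v (m≤n+m _ n))) (col (n<1+n n)))

  -- The indices from `q * k` up to `r + q * k`, exclusive, all have weight `suc q`.
  minSize-block : ∀ {r} q → r ≤ k → minSize (r + q * k) ≡ r * (suc q * k) + minSize (q * k)
  minSize-block {zero} q _ = refl
  minSize-block {suc r} q r<k = begin
    minSize (suc r + q * k)
      ≡⟨ *-distribʳ-+ k (sumBelow weight (r + q * k)) (weight (r + q * k)) ⟩
    minSize (r + q * k) + weight (r + q * k) * k
      ≡⟨ cong₂ (λ a b → a + suc b * k) (minSize-block q (<⇒≤ r<k)) (quotient-coordinate q r<k) ⟩
    r * (suc q * k) + minSize (q * k) + suc q * k
      ≡⟨ regroup (r * (suc q * k)) (minSize (q * k)) (suc q * k) ⟩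
    suc r * (suc q * k) + minSize (q * k) ∎
    where
    open ≡-Reasoning
    regroup : ∀ a b c → a + b + c ≡ c + a + b
    regroup = solve-∀

  0<k : 0 < k
  0<k = >-nonZero⁻¹ k

  k≤block : ∀ q → k ≤ suc q * k
  k≤block q = m≤m+n k (q * k)

  0<block : ∀ q → 0 < suc q * k
  0<block q = <-≤-trans 0<k (k≤block q)

  -- There are k rows of each length k, 2 k, ..., q k. The rows of length (i + 1) k occupy height 2
  -- i + 1 on every runner, and the size meets the lower bound exactly.
  staircase : ∀ q → Stack k (q * k) (q * k) (minSize (q * k)) (q * k)
  staircase zero = record
    { rows = [] ; sorted = [] ; bounded = [] ; rows>0 = [] ; length≡ = refl
    ; sum≡ = refl ; coloured = λ () ; hooks≥ = z≤n }
  staircase (suc q) = resize refl (sym (minSize-block q ≤-refl)) refl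
    (pushes k (staircase q) (m≤n+m (q * k) k) (0<block q) (≤-trans (k≤block q) (m≤m+n _ _))
      (λ {j} j<k → colour-odd q j<k (<⇒≢ j<k) (position j q k)))
    where
    position : ∀ j q k → suc q * k + (j + q * k) ≡ j + suc (q + q) * k
    position = solve-∀

  -- The remaining r beads sit at height 2 q + 1 and the c surplus cells are added
  -- to their rows, as a single column ...
  staircase+column : ∀ {r c} q → c ≤ r → r < k ⊎ (r ≤ k × c ≡ 0) →
    ∃ λ top → Stack k top (r + q * k) (c + minSize (r + q * k)) (r + q * k)
  staircase+column {r} {c} q c≤r r<k⊎c≡0 = suc v ,
    resize rows size rows
      (pushes c
        (pushes d (staircase q) (m≤n+m (q * k) k) (0<block q) (≤-trans (k≤block q) (m≤m+n _ _))
          (λ {j} j<d → colour-odd q (j<k j<d) (<⇒≢ (j<k j<d)) (position j q k)))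
        (n≤1+n v) z<s (≤-trans (k≤block q) (≤-trans (n≤1+n v) (m≤m+n _ _)))
        (λ {j} j<c → colour-odd q (1+j+d<k j<c) (<⇒≢ (1+j+d<k j<c)) (position′ j d q k)))
    where
    v = suc q * k
    -- The `d` rows of length `v` fill the runners below `d`. The `c` rows of length `suc v` skip
    -- runner `d` and end on runner `r`, which exists if r < k.
    d = r ∸ c
    c+d : c + d ≡ r
    c+d = m+[n∸m]≡n c≤r
    r≤k : r ≤ k
    r≤k = [ <⇒≤ , proj₁ ]′ r<k⊎c≡0
    j<k : ∀ {j} → j < d → j < k
    j<k j<d = <-≤-trans j<d (≤-trans (m∸n≤m r c) r≤k)
    1+j+d<k : ∀ {j} → j < c → suc j + d < k
    1+j+d<k j<c = ≤-<-trans (≤-trans (+-monoˡ-≤ d j<c) (≤-reflexive c+d))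
      ([ id , (λ (_ , c≡0) → contradiction (subst (_ <_) c≡0 j<c) λ ()) ]′ r<k⊎c≡0)
    position : ∀ j q k → suc q * k + (j + q * k) ≡ j + suc (q + q) * k
    position = solve-∀
    position′ : ∀ j d q k → suc (suc q * k) + (j + (d + q * k)) ≡ suc j + d + suc (q + q) * k
    position′ = solve-∀
    rows : c + (d + q * k) ≡ r + q * k
    rows = trans (sym (+-assoc c d _)) (cong (_+ q * k) c+d)
    regroup : ∀ c d v M → c * suc v + (d * v + M) ≡ c + ((c + d) * v + M)
    regroup = solve-∀
    size : c * suc v + (d * v + minSize (q * k)) ≡ c + minSize (r + q * k)
    size = trans (regroup c d v (minSize (q * k))) (cong (c +_) (trans
      (cong (λ x → x * v + minSize (q * k)) c+d) (sym (minSize-block q r≤k))))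

  -- ... or, when c exceeds r, as a hook.
  staircase+hook : ∀ {r c} q → suc r < c → c < k →
    ∃ λ top → Stack k top (suc r + q * k) (c + minSize (suc r + q * k)) (suc r + q * k)
  staircase+hook {r} {c} q 1+r<c c<k = v + e ,
    resize refl size refl
      (push
        (pushes r (staircase q) (m≤n⇒m≤1+n (m≤n+m (q * k) k)) z<s
          (≤-trans (k≤block q) (≤-trans (n≤1+n v) (m≤m+n _ _)))
          (λ {j} j<r → colour-odd q (1+j<k j<r) (<⇒≢ (1+j<k j<r)) (position j q k)))
        (≤-trans (≤-reflexive (+-comm 1 v)) (+-monoʳ-≤ v 1≤e))
        (<-≤-trans (0<block q) (m≤m+n v e))
        (≤-trans (k≤block q) (≤-trans (m≤m+n v e) (m≤m+n _ _)))
        (colour-odd q c<k (<⇒≢ c<k) (trans (position′ e r q k) (cong (_+ suc (q + q) * k) e+r))))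
    where
    v = suc q * k
    -- Of the `c` surplus cells, `r` lengthen the lower rows of the block by one each. The other `e`
    -- go to the top row and bring its bead to runner `c`.
    e = c ∸ r
    e+r : e + r ≡ c
    e+r = m∸n+n≡m (<⇒≤ (<-trans (n<1+n r) 1+r<c))
    1≤e : 1 ≤ e
    1≤e = m+n≤o⇒m≤o∸n 1 (<⇒≤ 1+r<c)
    1+j<k : ∀ {j} → j < r → suc j < k
    1+j<k j<r = ≤-<-trans (≤-trans j<r (n≤1+n r)) (<-trans 1+r<c c<k)
    position : ∀ j q k → suc (suc q * k) + (j + q * k) ≡ suc j + suc (q + q) * k
    position = solve-∀
    position′ : ∀ e r q k → suc q * k + e + (r + q * k) ≡ e + r + suc (q + q) * k
    position′ = solve-∀
    regroup : ∀ e r v M → v + e + (r * suc v + M) ≡ (e + r) + (suc r * v + M)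
    regroup = solve-∀
    size : v + e + (r * suc v + minSize (q * k)) ≡ c + minSize (suc r + q * k)
    size = trans (regroup e r v (minSize (q * k))) (cong₂ _+_ e+r
      (sym (minSize-block q (<⇒≤ (<-trans 1+r<c c<k)))))

  -- When k divides m and c > 0 no set of m beads works.  With one more bead,
  -- runner c is occupied at even heights and the other runners at odd heights.
  shiftedStaircase : ∀ {c} q → 0 < c → c < k →
    Stack c (q * k + c) (suc (q * k)) (c + minSize (q * k)) (q * k)
  shiftedStaircase {c} zero 0<c c<k = record
    -- The additional bead starts at height 0 on runner `c`; lying below k, it gives no hook of
    -- length k.
    { rows = c ∷ [] ; sorted = [] ∷ [] ; bounded = ≤-refl ∷ [] ; rows>0 = 0<c ∷ []
    ; length≡ = refl ; sum≡ = refl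
    ; coloured = λ where (here refl) → colour-even 0 c<k refl
    ; hooks≥ = z≤n }
  shiftedStaircase {c} (suc q) 0<c c<k =
    -- One block consists of `c` rows of length `w` on the runners below `c`, `d` rows of length `v`
    -- on those above, all at height 2 q + 1, and one row of length `v + c` at height 2 q + 2 on
    -- runner `c`.
    resize len size count
      (push
        (pushes d
          (pushes c (shiftedStaircase q 0<c c<k) qk+c≤w 0<w k≤w+1
            (λ {j} j<c → colour-odd q (<-trans j<c c<k) (<⇒≢ j<c)
              (trans (shift w j (q * k)) (trans (cong (_+ (j + q * k)) 1+w) (position j q k)))))
          (≤-trans (n≤1+n w) (≤-reflexive 1+w)) (0<block q) (≤-trans (k≤block q) (m≤m+n _ _))
          (λ {j} j<d → colour-odd q
            (≤-trans (≤-reflexive (cong suc (+-comm (suc j) c)))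
              (≤-trans (s≤s (+-monoʳ-≤ c j<d)) (≤-reflexive 1+c+d)))
            (λ eq → <⇒≢ (m<n+m c z<s) (sym eq))
            (position′ j c q k)))
        (m≤m+n v c) (<-≤-trans (0<block q) (m≤m+n v c))
        (≤-trans (k≤block q) (≤-trans (m≤m+n v c) (m≤m+n _ _)))
        (colour-even (suc q) c<k (trans (regroup v c d (q * k))
          (trans (cong (λ κ → v + c + (κ + q * k)) 1+c+d) (position″ c q k)))))
    where
    v = suc q * k
    -- The additional row below raises every place by one, so these rows are one cell shorter. The
    -- `c` cells saved go to the last row of the block, whose total stays `k * v`.
    w = pred v
    d = k ∸ suc c
    1+w : suc w ≡ v
    1+w = suc-pred v {{>-nonZero (0<block q)}}
    1+c+d : suc c + d ≡ k
    1+c+d = m+[n∸m]≡n c<k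
    qk+c≤w : q * k + c ≤ w
    qk+c≤w = <⇒≤pred (≤-trans (+-monoʳ-< (q * k) c<k) (≤-reflexive (+-comm (q * k) k)))
    0<w : 0 < w
    0<w = <-≤-trans 0<c (≤-trans (m≤n+m c (q * k)) qk+c≤w)
    k≤w+1 : k ≤ w + suc (q * k)
    k≤w+1 = ≤-trans (k≤block q) (≤-trans (≤-reflexive (trans (sym 1+w) (+-comm 1 w)))
      (+-monoʳ-≤ w (s≤s z≤n)))
    shift : ∀ w j l → w + (j + suc l) ≡ suc w + (j + l)
    shift = solve-∀
    position : ∀ j q k → suc q * k + (j + q * k) ≡ j + suc (q + q) * k
    position = solve-∀
    position′ : ∀ j c q k → suc q * k + (j + (c + suc (q * k))) ≡ suc j + c + suc (q + q) * k
    position′ = solve-∀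
    regroup : ∀ v c d l → v + c + (d + (c + suc l)) ≡ v + c + (suc c + d + l)
    regroup = solve-∀
    position″ : ∀ c q k → suc q * k + c + (k + q * k) ≡ c + (suc q + suc q) * k
    position″ = solve-∀
    len : suc (d + (c + suc (q * k))) ≡ suc (suc q * k)
    len = cong suc (trans (len′ d c (q * k)) (cong (_+ q * k) 1+c+d))
      where
      len′ : ∀ d c l → d + (c + suc l) ≡ suc c + d + l
      len′ = solve-∀
    count : suc (d + (c + q * k)) ≡ suc q * k
    count = trans (count′ d c (q * k)) (cong (_+ q * k) 1+c+d)
      where
      count′ : ∀ d c l → suc (d + (c + l)) ≡ suc c + d + l
      count′ = solve-∀
    size : v + c + (d * v + (c * w + (c + minSize (q * k)))) ≡ c + minSize (suc q * k)
    size = begin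
      v + c + (d * v + (c * w + (c + M)))              ≡⟨ cong (λ v → v + c + (d * v + (c * w + (c + M)))) 1+w ⟨
      suc w + c + (d * suc w + (c * w + (c + M)))      ≡⟨ size′ c d w M ⟩
      c + ((suc c + d) * suc w + M)                    ≡⟨ cong₂ (λ a b → c + (a * b + M)) 1+c+d 1+w ⟩
      c + (k * v + M)                                  ≡⟨ cong (c +_) (minSize-block q ≤-refl) ⟨
      c + minSize (suc q * k)                          ∎
      where
      open ≡-Reasoning
      M = minSize (q * k)
      size′ : ∀ c d w M → suc w + c + (d * suc w + (c * w + (c + M))) ≡ c + ((suc c + d) * suc w + M)
      size′ = solve-∀

  -- Dividing `m` rather than `suc m` makes the last block have between 1 and k hooks. The shifted
  -- staircase serves a full last block with c > 0.
  stack : ∀ {c} m → c < k → ∃ λ κ → ∃ λ top → ∃ λ len → Stack κ top len (c + minSize (suc m)) (suc m)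
  stack {c} m c<k = subst (λ m → ∃ λ κ → ∃ λ top → ∃ λ len → Stack κ top len (c + minSize m) m)
    (cong suc (sym (m≡m%n+[m/n]*n m k))) found
    where
    r = m % k
    q = m / k
    found : ∃ λ κ → ∃ λ top → ∃ λ len → Stack κ top len (c + minSize (suc r + q * k)) (suc r + q * k)
    found with c ≤? suc r | m≤n⇒m<n∨m≡n (m%n<n m k)
    ... | no c≰r   | _ = _ , _ , _ , proj₂ (staircase+hook q (≰⇒> c≰r) c<k)
    ... | yes c≤r | inj₁ 1+r<k = _ , _ , _ , proj₂ (staircase+column q c≤r (inj₁ 1+r<k))
    ... | yes c≤r | inj₂ 1+r≡k with 0 <? c
    ...   | no 0≮c = _ , _ , _ , proj₂ (staircase+column q c≤r (inj₂ (≤-reflexive 1+r≡k , n≤0⇒n≡0 (≮⇒≥ 0≮c))))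
    ...   | yes 0<c = subst (λ r → ∃ λ κ → ∃ λ top → ∃ λ len → Stack κ top len (c + minSize (r + q * k)) (r + q * k))
      (sym 1+r≡k) (_ , _ , _ , shiftedStaircase (suc q) 0<c c<k)

  -- The place left by the largest bead is empty, as all other beads are smaller. So the first row
  -- now has a hook of length k, while before it had at most one.
  hooks-raise : ∀ {r rs} → AllPairs _≥_ (r ∷ rs) → hooks k (r ∷ rs) ≤ hooks k (k + r ∷ rs)
  hooks-raise {r} {rs} (r≥rs ∷ rs≥) = subst₂ _≤_ (sym (hooks-∷ k r rs)) (sym (hooks-∷ k (k + r) rs))
    (+-monoˡ-≤ (hooks k rs) (≤-trans (rowHooks≤1 k r rs)
      (∉beta⇒rowHooks {y = r + length rs} (All.map (λ p → ≤-trans p (m≤n+m r k)) r≥rs ∷ rs≥)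
        (trans (+-comm _ k) (sym (+-assoc k r _)))
        (λ x∈ → <-irrefl refl (beta-< r≥rs x∈)))))

  raise : ∀ {r rs} f → AllPairs _≥_ (r ∷ rs) → AllPairs _≥_ (f * k + r ∷ rs) × hooks k (r ∷ rs) ≤ hooks k (f * k + r ∷ rs)
  raise zero rs≥ = rs≥ , ≤-refl
  raise {r} {rs} (suc f) rs≥ with raise f rs≥
  ... | rs≥′@(p ∷ ps) , le rewrite +-assoc k (f * k) r =
    (All.map (λ q → ≤-trans q (m≤n+m _ k)) p ∷ ps) , ≤-trans le (hooks-raise rs≥′)

  manyHooks : ∀ m {n} → minSize m ≤ n →
              ∃ λ rs → AllPairs _≥_ rs × All (_> 0) rs × sum rs ≡ n × m ≤ hooks k rs
  -- No hook is required here; parts must be positive, so only n = 0 takes the empty list.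
  manyHooks zero {zero} _ = [] , [] , [] , refl , z≤n
  manyHooks zero {suc n} _ = suc n ∷ [] , [] ∷ [] , z<s ∷ [] , +-identityʳ _ , z≤n
  manyHooks (suc m) {n} min≤n with stack m (m%n<n (n ∸ minSize (suc m)) k)
  -- A stack with at least one hook has a row to lengthen.
  ... | _ , _ , _ , record { rows = [] ; hooks≥ = () }
  ... | _ , _ , _ , record { rows = r ∷ rs ; sorted = rs≥ ; rows>0 = 0<r ∷ 0<rs ; sum≡ = sum≡ ; hooks≥ = hooks≥ }
    with raise (excess / k) rs≥
    where excess = n ∸ minSize (suc m)
  ...   | rs≥′ , le = excess / k * k + r ∷ rs , rs≥′ , <-≤-trans 0<r (m≤n+m r _) ∷ 0<rs , size , ≤-trans hooks≥ le
    where
    open ≡-Reasoning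
    excess = n ∸ minSize (suc m)
    regroup : ∀ a b c → a + (b + c) ≡ (b + a) + c
    regroup = solve-∀
    size : excess / k * k + r + sum rs ≡ n
    size = begin
      excess / k * k + r + sum rs                          ≡⟨ +-assoc (excess / k * k) r _ ⟩
      excess / k * k + (r + sum rs)                        ≡⟨ cong (excess / k * k +_) sum≡ ⟩
      excess / k * k + (excess % k + minSize (suc m))      ≡⟨ regroup (excess / k * k) (excess % k) _ ⟩
      (excess % k + excess / k * k) + minSize (suc m)      ≡⟨ cong (_+ minSize (suc m)) (m≡m%n+[m/n]*n excess k) ⟨
      excess + minSize (suc m)                             ≡⟨ m∸n+n≡m min≤n ⟩
      n                                                    ∎

-- The closed form of t.

module ClosedForm (k : ℕ) .{{_ : NonZero k}} where

  open import Data.Integer.Base as ℤ using (ℤ; +_)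
  import Data.Integer.Properties as ℤ
  open import Data.Nat.Base
  open import Data.Nat.Combinatorics using (_C_; nC1≡n; nCk+nC[k+1]≡[n+1]C[k+1])
  open import Data.Nat.DivMod
  open import Data.Nat.Properties
  open import Data.Nat.Tactic.RingSolver using (solve-∀)
  open import Relation.Binary.PropositionalEquality
  open Runners k using (minSize)
  open Construction k using (minSize-block)

  -- Here `minSize (q * k)` is k^2 (1 + ... + q). The binomial term stands on the left to avoid
  -- subtraction, and Pascal's rule drives the induction.
  minSize-multiple : ∀ q → minSize (q * k) + (suc q C 2) * k ^ 2 ≡ q * k * suc q * k
  minSize-multiple zero = refl
  minSize-multiple (suc q) = begin
    minSize (suc q * k) + (suc (suc q) C 2) * k ^ 2
      ≡⟨ cong₂ (λ a b → a + b * k ^ 2) (minSize-block q ≤-refl) pascal ⟩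
    k * (suc q * k) + minSize (q * k) + (suc q + (suc q C 2)) * k ^ 2
      ≡⟨ regroup k q (minSize (q * k)) (suc q C 2) ⟩
    k * (suc q * k) + suc q * (k * k) + (minSize (q * k) + (suc q C 2) * k ^ 2)
      ≡⟨ cong (λ a → k * (suc q * k) + suc q * (k * k) + a) (minSize-multiple q) ⟩
    k * (suc q * k) + suc q * (k * k) + q * k * suc q * k
      ≡⟨ collect k q ⟩
    suc q * k * suc (suc q) * k ∎
    where
    open ≡-Reasoning
    pascal : suc (suc q) C 2 ≡ suc q + (suc q C 2)
    pascal = trans (sym (nCk+nC[k+1]≡[n+1]C[k+1] (suc q) 1)) (cong (_+ (suc q C 2)) (nC1≡n (suc q)))
    -- The factor `k * (k * 1)` is `k ^ 2` unfolded, as the ring solver has to see it.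
    regroup : ∀ k q M B → k * (suc q * k) + M + (suc q + B) * (k * (k * 1)) ≡
              k * (suc q * k) + suc q * (k * k) + (M + B * (k * (k * 1)))
    regroup = solve-∀
    collect : ∀ k q → k * (suc q * k) + suc q * (k * k) + q * k * suc q * k ≡ suc q * k * suc (suc q) * k
    collect = solve-∀

  -- The full blocks are covered by `minSize-multiple`, and the remaining r = m % k indices each
  -- contribute (q + 1) k.
  minSize-closed : ∀ m → minSize m + ((m / k + 1) C 2) * k ^ 2 ≡ m * (m / k + 1) * k
  minSize-closed m = begin
    minSize m + ((q + 1) C 2) * k ^ 2
      ≡⟨ cong₂ (λ m q′ → minSize m + (q′ C 2) * k ^ 2) m≡ (+-comm q 1) ⟩
    minSize (r + q * k) + (suc q C 2) * k ^ 2
      ≡⟨ cong (λ a → a + (suc q C 2) * k ^ 2) (minSize-block q (<⇒≤ (m%n<n m k))) ⟩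
    r * (suc q * k) + minSize (q * k) + (suc q C 2) * k ^ 2
      ≡⟨ +-assoc (r * (suc q * k)) _ _ ⟩
    r * (suc q * k) + (minSize (q * k) + (suc q C 2) * k ^ 2)
      ≡⟨ cong (λ a → r * (suc q * k) + a) (minSize-multiple q) ⟩
    r * (suc q * k) + q * k * suc q * k
      ≡⟨ collect r q k ⟩
    (r + q * k) * (q + 1) * k
      ≡⟨ cong (λ m → m * (q + 1) * k) m≡ ⟨
    m * (q + 1) * k ∎
    where
    open ≡-Reasoning
    q = m / k
    r = m % k
    m≡ : m ≡ r + q * k
    m≡ = m≡m%n+[m/n]*n m k
    collect : ∀ r q k → r * (suc q * k) + q * k * suc q * k ≡ (r + q * k) * (q + 1) * k
    collect = solve-∀

  t≡minSize : ∀ m → t m k ≡ + minSize m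
  t≡minSize m = begin
    + (m * (m / k + 1) * k) ℤ.- + B  ≡⟨ cong (λ a → + a ℤ.- + B) (minSize-closed m) ⟨
    + (minSize m + B) ℤ.- + B        ≡⟨ ℤ.m-n≡m⊖n (minSize m + B) B ⟩
    (minSize m + B) ℤ.⊖ B            ≡⟨ ℤ.⊖-≥ (m≤n+m B (minSize m)) ⟩
    + (minSize m + B ∸ B)            ≡⟨ cong +_ (m+n∸n≡m (minSize m) B) ⟩
    + minSize m                      ∎
    where
    open ≡-Reasoning
    B = ((m / k + 1) C 2) * k ^ 2

-- Combining the two bounds.

module Maximum (k : ℕ) .{{_ : NonZero k}} where

  open import Data.List.Relation.Unary.Linked.Properties using (Linked⇒AllPairs; AllPairs⇒Linked)
  open import Data.Nat.Base
  open import Data.Nat.Properties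
  open import Data.Product.Base using (_,_)
  open import Relation.Binary.PropositionalEquality
  open Hooks using (hooks)
  open Runners k using (minSize; minSize-mono; minSize-hooks)
  open Construction k using (manyHooks)

  -- More than `m` hooks would force the size up to at least `minSize (suc m)`.
  hooks-bound : ∀ {m n} → n < minSize (suc m) → (p : Partition n) → α k p ≤ m
  hooks-bound {m} n< p = ≮⇒≥ λ m<α → <⇒≱ n< (begin
    minSize (suc m)             ≤⟨ minSize-mono m<α ⟩
    minSize (hooks k (parts p)) ≤⟨ minSize-hooks (Linked⇒AllPairs (λ x≥y y≥z → ≤-trans y≥z x≥y) (decreasing p)) ⟩
    sum (parts p)               ≡⟨ sums p ⟩
    _                           ∎)
    where
    open ≤-Reasoning
    open import Data.Nat.ListAction using (sum)

  maximum : ∀ {m n} → minSize m ≤ n → n < minSize (suc m) → b[ n , k ]≡ m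
  maximum {m} {n} min≤n n< with manyHooks m min≤n
  ... | rs , rs≥ , 0<rs , sum≡n , m≤hooks = (p , ≤-antisym (hooks-bound n< p) m≤hooks) , hooks-bound n<
    where
    p : Partition n
    p = record { parts = rs ; decreasing = AllPairs⇒Linked rs≥ ; positive = 0<rs ; sums = sum≡n }

open import Data.Integer.Base using (+_; 1ℤ; -1ℤ; _≤_; _<_; _-_)
import Data.Integer.Properties as ℤ
open import Data.Nat.Properties using (+-comm)
open import Relation.Binary.PropositionalEquality using (subst; cong; trans)

theorem4p1 : (m k n : ℕ) .{{_ : NonZero k}} →
    t m k ≤ + n → + n ≤ t (m + 1) k - 1ℤ →
    b[ n , k ]≡ m
theorem4p1 m k n tm≤n n≤tm+1 = Maximum.maximum k
  (ℤ.drop‿+≤+ (subst (_≤ + n) (t≡minSize m) tm≤n))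
  (ℤ.drop‿+<+ (subst (+ n <_) (trans (cong (λ s → t s k) (+-comm m 1)) (t≡minSize _))
    -- The integer predecessor is `-1ℤ + j`, so the summands are swapped before the bound becomes
    -- strict.
    (ℤ.i≤pred[j]⇒i<j (subst (+ n ≤_) (ℤ.+-comm (t (m + 1) k) -1ℤ) n≤tm+1))))
  where open ClosedForm k
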